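{- For every graph $G$, $$\operatorname{diam}(G)\ \le\ \max\bigl(4\chi_a(G)-7,\,2\bigr)\ \le\ \max\bigl(4\chi_s(G)-7,\,2\bigr).$$
   Context: Graphs are finite and simple. For an oriented graph $\overrightarrow{G}$ and $X\subseteq V(\overrightarrow{G})$, the inversion of $X$ reverses every arc having both endpoints in $X$ (and no other arc). For a (labeled) graph $G$, the inversion distance between two orientations of $G$ is the minimum number of inversions transforming one into the other (equality as labeled oriented graphs), and the inversion diameter $\operatorname{diam}(G)$ is the maximum inversion distance over all pairs of orientations of $G$. The acyclic chromatic number $\chi_a(G)$ (resp. star chromatic number $\chi_s(G)$) is the minimum number of colors in a proper vertex-coloring of $G$ such that the union of any two color classes induces a forest (resp. a star forest, i.e. a forest each of whose components is a star). -}

module Defs where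

open import Data.Bool using (Bool; true; false; T; _∧_; _∨_; if_then_else_)
open import Data.Bool.Properties using (T?) renaming (_≟_ to _≟ᵇ_)
open import Data.Empty using (⊥; ⊥-elim)
open import Data.Fin using (Fin; zero; suc; _≟_; toℕ; fromℕ<)
open import Data.Fin.Properties using (any?; all?; injective⇒≤; toℕ-injective; toℕ-fromℕ<)
open import Data.Fin.Subset using (Subset; ⁅_⁆; _∪_; _∈_)
open import Data.Fin.Subset.Properties
  using (_∈?_; anySubset?; x∈⁅x⁆; x∈⁅y⁆⇒x≡y; x∈p∪q⁺; x∈p∪q⁻)
open import Data.List using (List; []; _∷_; _∷ʳ_; length; cartesianProduct; allFin)
import Data.List as List
open import Data.List.Membership.Propositional.Properties
  using (∈-lookup; ∈-cartesianProduct⁺; ∈-allFin)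
open import Data.List.Relation.Unary.All as All using (All; []; _∷_)
open import Data.List.Relation.Unary.AllPairs using ([]; _∷_)
open import Data.List.Relation.Unary.Linked as Linked using (Linked; _∷_; linked?)
open import Data.List.Relation.Unary.Unique.Propositional using (Unique)
import Data.List.Relation.Unary.Unique.DecPropositional as DecUnique
open import Data.Nat using (ℕ; zero; suc; _≤_; _<_; z≤n; s≤s; _<ᵇ_)
open import Data.Nat.Properties
  using (≤-refl; ≤-trans; ≤-antisym; n≤1+n; ≮⇒≥; ≤∧≢⇒<; ≤-pred; <⇒≱; <ᵇ⇒<; <⇒<ᵇ)
  renaming (_≟_ to _≟ℕ_)
open import Data.Product using (∃; ∃₂; _×_; _,_; proj₁; proj₂)
open import Data.Sum using (_⊎_; inj₁; inj₂)
import Data.Sum as Sum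
open import Data.Vec using (Vec; []; _∷_; lookup; tabulate; foldr′; toList; fromList)
open import Data.Vec.Properties using (lookup∘tabulate; toList∘fromList)
open import Function using (_∘_; id; case_of_)
open import Level using (0ℓ)
open import Relation.Binary using (Rel; Symmetric)
import Relation.Binary as B
open import Relation.Binary.Construct.Closure.ReflexiveTransitive using (Star; ε; _◅_; _◅◅_)
open import Relation.Binary.PropositionalEquality
  using (_≡_; _≢_; refl; sym; trans; cong; subst)
open import Relation.Nullary using (¬_; Dec; yes; no; does; contradiction; ¬?)
open import Relation.Nullary.Decidable using (map′; _×-dec_; _⊎-dec_; _→-dec_; dec-true)
open import Relation.Unary using (Pred; Decidable)

IsLeast IsGreatest : Pred ℕ 0ℓ → Pred ℕ 0ℓ
IsLeast    P k = P k × (∀ {j} → P j → k ≤ j)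
IsGreatest P k = P k × (∀ {j} → P j → j ≤ k)

private
  abstract
    least : ∀ {P : Pred ℕ 0ℓ} → Decidable P → ∃ P → ∃ (IsLeast P)
    least {P} P? (n , Pn) = go n (≤-refl {n})
      where
      below : ∀ m → (∃ (IsLeast P)) ⊎ (∀ {j} → P j → m ≤ j)
      below zero = inj₂ λ _ → z≤n
      below (suc m) with below m
      ... | inj₁ found = inj₁ found
      ... | inj₂ lb with P? m
      ...   | yes Pm = inj₁ (m , Pm , lb)
      ...   | no ¬Pm = inj₂ λ Pj → ≤∧≢⇒< (lb Pj) λ { refl → ¬Pm Pj }
      go : ∀ m → n ≤ m → ∃ (IsLeast P)
      go m n≤m with below (suc m)
      ... | inj₁ found = found
      ... | inj₂ lb = contradiction n≤m (<⇒≱ (lb Pn))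

    least-unique : ∀ {P Q : Pred ℕ 0ℓ} {j k} → (∀ {i} → P i → Q i) → (∀ {i} → Q i → P i) →
                   IsLeast P j → IsLeast Q k → j ≡ k
    least-unique f g (Pj , lbj) (Qk , lbk) = ≤-antisym (lbj (g Qk)) (lbk (f Pj))

    greatest : ∀ {P : Pred ℕ 0ℓ} → Decidable P → ∃ P → ∀ b → (∀ {j} → P j → j ≤ b) → ∃ (IsGreatest P)
    greatest {P} P? (n , Pn) b ub with P? b
    ... | yes Pb = b , Pb , ub
    greatest P? (n , Pn) zero ub | no ¬Pb with z≤n ← ub Pn = contradiction Pn ¬Pb
    greatest P? w (suc b) ub | no ¬Pb =
      greatest P? w b λ Pj → ≤-pred (≤∧≢⇒< (ub Pj) λ { refl → ¬Pb Pj })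

record Graph (n : ℕ) : Set where
  field
    edge        : Fin n → Fin n → Bool
    symmetric   : ∀ u v → edge u v ≡ edge v u
    irreflexive : ∀ v → edge v v ≡ false

  Adjacent : Rel (Fin n) 0ℓ
  Adjacent u v = T (edge u v)

open Graph

record Orientation {n : ℕ} (G : Graph n) : Set where
  field
    arc        : Fin n → Fin n → Bool
    underlying : ∀ u v → arc u v ∨ arc v u ≡ edge G u v
    oneWay     : ∀ u v → arc u v ∧ arc v u ≡ false

open Orientation

module _ {n : ℕ} {G : Graph n} where

  _≈_ : Rel (Orientation G) 0ℓ
  o ≈ o′ = ∀ u v → arc o u v ≡ arc o′ u v

  invert : Subset n → Orientation G → Orientation G
  invert X o .arc u v = if does (u ∈? X) ∧ does (v ∈? X) then arc o v u else arc o u v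
  invert X o .underlying u v with does (u ∈? X) | does (v ∈? X)
  ... | true  | true  = trans (underlying o v u) (symmetric G v u)
  ... | true  | false = underlying o u v
  ... | false | true  = underlying o u v
  ... | false | false = underlying o u v
  invert X o .oneWay u v with does (u ∈? X) | does (v ∈? X)
  ... | true  | true  = oneWay o v u
  ... | true  | false = oneWay o u v
  ... | false | true  = oneWay o u v
  ... | false | false = oneWay o u v

  InvertibleIn : Orientation G → Orientation G → Pred ℕ 0ℓ
  InvertibleIn o o′ k = ∃ λ (Xs : Vec (Subset n) k) → foldr′ invert o Xs ≈ o′

private
  Searchable : Set → Set₁
  Searchable A = ∀ {P : Pred A 0ℓ} → Decidable P → Dec (∃ P)

  abstract
    searchVec : ∀ {A} → Searchable A → ∀ k → Searchable (Vec A k)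
    searchVec s zero    P? = map′ (λ p → [] , p) (λ { ([] , p) → p }) (P? [])
    searchVec s (suc k) P? =
      map′ (λ (x , xs , p) → x ∷ xs , p) (λ { (x ∷ xs , p) → x , xs , p })
           (s λ x → searchVec s k λ xs → P? (x ∷ xs))

  module _ {n : ℕ} {G : Graph n} where

    abstract
      _≈?_ : B.Decidable (_≈_ {G = G})
      o ≈? o′ = all? λ u → all? λ v → arc o u v ≟ᵇ arc o′ u v

      invertibleIn? : (o o′ : Orientation G) → Decidable (InvertibleIn o o′)
      invertibleIn? o o′ k = searchVec anySubset? k λ Xs → foldr′ invert o Xs ≈? o′

      invert-cong : ∀ X {o o′ : Orientation G} → o ≈ o′ → invert X o ≈ invert X o′
      invert-cong X eq u v with does (u ∈? X) ∧ does (v ∈? X)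
      ... | true  = eq v u
      ... | false = eq u v

      foldr-cong : ∀ {k} (Xs : Vec (Subset n) k) {o o′ : Orientation G} → o ≈ o′ →
                   foldr′ invert o Xs ≈ foldr′ invert o′ Xs
      foldr-cong []       eq = eq
      foldr-cong (X ∷ Xs) {o} {o′} eq =
        invert-cong X {foldr′ invert o Xs} {foldr′ invert o′ Xs} (foldr-cong Xs {o} {o′} eq)

      agree-swap : ∀ (o o′ : Orientation G) u v → arc o u v ≡ arc o′ u v → arc o v u ≡ arc o′ v u
      agree-swap o o′ u v eq
        with arc o u v | arc o v u | arc o′ u v | arc o′ v u
           | trans (underlying o u v) (sym (underlying o′ u v)) | oneWay o u v | oneWay o′ u v
      ... | true  | b | true  | b′ | e | p | q = trans p (sym q)
      ... | false | b | false | b′ | e | p | q = e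
      agree-swap o o′ u v () | true | _ | false | _ | _ | _ | _
      agree-swap o o′ u v () | false | _ | true | _ | _ | _ | _

      disagree-swap : ∀ (o o′ : Orientation G) u v → ¬ arc o u v ≡ arc o′ u v → arc o v u ≡ arc o′ u v
      disagree-swap o o′ u v ne
        with arc o u v | arc o v u | arc o′ u v | arc o′ v u
           | trans (underlying o u v) (sym (underlying o′ u v)) | oneWay o u v
      ... | true  | b | true  | _ | _ | _ = contradiction refl ne
      ... | true  | b | false | _ | _ | p = p
      ... | false | b | true  | _ | e | _ = e
      ... | false | b | false | _ | _ | _ = contradiction refl ne

      pair⁻ : ∀ (u v x : Fin n) → x ∈ ⁅ u ⁆ ∪ ⁅ v ⁆ → x ≡ u ⊎ x ≡ v
      pair⁻ u v x = Sum.map (x∈⁅y⁆⇒x≡y u) (x∈⁅y⁆⇒x≡y v) ∘ x∈p∪q⁻ ⁅ u ⁆ ⁅ v ⁆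

      flipped : ∀ (o o′ : Orientation G) u v → ¬ arc o u v ≡ arc o′ u v →
                arc (invert (⁅ u ⁆ ∪ ⁅ v ⁆) o) u v ≡ arc o′ u v
      flipped o o′ u v ne
        rewrite dec-true (u ∈? (⁅ u ⁆ ∪ ⁅ v ⁆)) (x∈p∪q⁺ {q = ⁅ v ⁆} (inj₁ (x∈⁅x⁆ u)))
              | dec-true (v ∈? (⁅ u ⁆ ∪ ⁅ v ⁆)) (x∈p∪q⁺ {p = ⁅ u ⁆} (inj₂ (x∈⁅x⁆ v)))
        = disagree-swap o o′ u v ne

      preserved : ∀ (o o′ : Orientation G) u v → ¬ arc o u v ≡ arc o′ u v → ∀ x y →
                  arc o x y ≡ arc o′ x y → arc (invert (⁅ u ⁆ ∪ ⁅ v ⁆) o) x y ≡ arc o′ x y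
      preserved o o′ u v ne x y eq with x ∈? (⁅ u ⁆ ∪ ⁅ v ⁆) | y ∈? (⁅ u ⁆ ∪ ⁅ v ⁆)
      ... | no _  | _     = eq
      ... | yes _ | no _  = eq
      ... | yes p | yes q with pair⁻ u v x p | pair⁻ u v y q
      ...   | inj₁ refl | inj₁ refl = eq
      ...   | inj₂ refl | inj₂ refl = eq
      ...   | inj₁ refl | inj₂ refl = contradiction eq ne
      ...   | inj₂ refl | inj₁ refl = contradiction (agree-swap o o′ v u eq) ne

      steer : ∀ (o o′ : Orientation G) (L : List (Fin n × Fin n)) → ∃ λ k → k ≤ length L ×
              ∃ λ (Xs : Vec (Subset n) k) →
                All (λ (u , v) → arc (foldr′ invert o Xs) u v ≡ arc o′ u v) L
      steer o o′ [] = 0 , z≤n , [] , []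
      steer o o′ ((u , v) ∷ L) with steer o o′ L
      ... | k , k≤ , Xs , eqs with arc (foldr′ invert o Xs) u v ≟ᵇ arc o′ u v
      ...   | yes eq = k , ≤-trans k≤ (n≤1+n _) , Xs , eq ∷ eqs
      ...   | no ne  = suc k , s≤s k≤ , (⁅ u ⁆ ∪ ⁅ v ⁆) ∷ Xs ,
                       flipped o₁ o′ u v ne ∷ All.map (λ {p} → preserved o₁ o′ u v ne (proj₁ p) (proj₂ p)) eqs
        where
        o₁ : Orientation G
        o₁ = foldr′ invert o Xs

      pairs : List (Fin n × Fin n)
      pairs = cartesianProduct (allFin n) (allFin n)

      bounded : ∀ o o′ → ∃ λ k → k ≤ length pairs × InvertibleIn {G = G} o o′ k
      bounded o o′ with steer o o′ pairs
      ... | k , k≤ , Xs , eqs =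
        k , k≤ , Xs , λ u v → All.lookup eqs (∈-cartesianProduct⁺ (∈-allFin u) (∈-allFin v))

      increasing : Orientation G
      increasing .arc u v = edge G u v ∧ (toℕ u <ᵇ toℕ v)
      increasing .underlying u v rewrite symmetric G v u
        with edge G u v in e | toℕ u <ᵇ toℕ v in a | toℕ v <ᵇ toℕ u in b
      ... | false | _     | _     = refl
      ... | true  | true  | _     = refl
      ... | true  | false | true  = refl
      ... | true  | false | false = contradiction (trans (sym e) e′) λ ()
        where
        ge : ∀ {x y : Fin n} → (toℕ x <ᵇ toℕ y) ≡ false → toℕ y ≤ toℕ x
        ge f = ≮⇒≥ λ x<y → subst T f (<⇒<ᵇ x<y)
        u≡v : u ≡ v
        u≡v = toℕ-injective (≤-antisym (ge {v} {u} b) (ge {u} {v} a))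
        e′ : edge G u v ≡ false
        e′ = trans (cong (edge G u) (sym u≡v)) (irreflexive G u)
      increasing .oneWay u v
        with edge G u v | edge G v u | toℕ u <ᵇ toℕ v in a | toℕ v <ᵇ toℕ u in b
      ... | false | _     | _     | _     = refl
      ... | true  | _     | false | _     = refl
      ... | true  | false | true  | _     = refl
      ... | true  | true  | true  | false = refl
      ... | true  | true  | true  | true  =
        contradiction (≤-trans (n≤1+n _) (<ᵇ⇒< (toℕ u) (toℕ v) (subst T (sym a) _)))
                      (<⇒≱ (<ᵇ⇒< (toℕ v) (toℕ u) (subst T (sym b) _)))

      searchOrientation : ∀ {P : Pred (Orientation G) 0ℓ} → (∀ {o o′} → o ≈ o′ → P o → P o′) →
                          Decidable P → Dec (∃ P)
      searchOrientation {P} resp P? =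
        map′ (λ (_ , a , b , p) → _ , p) from (searchVec anySubset? n Q?)
        where
        at : Vec (Subset n) n → Fin n → Fin n → Bool
        at m u v = lookup (lookup m u) v
        Q : Pred (Vec (Subset n) n) 0ℓ
        Q m = ∃₂ λ a b → P (record { arc = at m ; underlying = a ; oneWay = b })
        Q? : Decidable Q
        Q? m with all? (λ u → all? λ v → (at m u v ∨ at m v u) ≟ᵇ edge G u v)
                | all? (λ u → all? λ v → (at m u v ∧ at m v u) ≟ᵇ false)
        ... | no ¬a | _     = no λ (a , _) → ¬a a
        ... | yes _ | no ¬b = no λ (_ , b , _) → ¬b b
        ... | yes a | yes b =
          map′ (λ p → a , b , p) (λ (_ , _ , p) → resp (λ _ _ → refl) p) (P? _)
        from : ∃ P → ∃ Q
        from (o , p) = m , und , one , resp (λ u v → sym (look u v)) p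
          where
          m : Vec (Subset n) n
          m = tabulate λ u → tabulate (arc o u)
          look : ∀ u v → at m u v ≡ arc o u v
          look u v rewrite lookup∘tabulate (λ x → tabulate (arc o x)) u = lookup∘tabulate (arc o u) v
          und : ∀ u v → at m u v ∨ at m v u ≡ edge G u v
          und u v rewrite look u v | look v u = underlying o u v
          one : ∀ u v → at m u v ∧ at m v u ≡ false
          one u v rewrite look u v | look v u = oneWay o u v

abstract
  distance-exists : ∀ {n} {G : Graph n} (o o′ : Orientation G) → ∃ (IsLeast (InvertibleIn o o′))
  distance-exists o o′ with bounded o o′
  ... | k , _ , reach = least (invertibleIn? o o′) (k , reach)

inversionDistance : ∀ {n} {G : Graph n} → Orientation G → Orientation G → ℕ
inversionDistance o o′ = proj₁ (distance-exists o o′)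

IsInversionDistanceIn : ∀ {n} → Graph n → Pred ℕ 0ℓ
IsInversionDistanceIn G d = ∃₂ λ (o o′ : Orientation G) → inversionDistance o o′ ≡ d

abstract
  diam-exists : ∀ {n} (G : Graph n) → ∃ (IsGreatest (IsInversionDistanceIn G))
  diam-exists {n} G = greatest attained? (_ , increasing , increasing , refl) (length (pairs {G = G})) ub
    where
    dist-cong : ∀ {o₁ o₂ o₁′ o₂′ : Orientation G} → o₁ ≈ o₂ → o₁′ ≈ o₂′ →
                inversionDistance o₁ o₁′ ≡ inversionDistance o₂ o₂′
    dist-cong {o₁} {o₂} {o₁′} {o₂′} eq eq′ = least-unique
      (λ (Xs , p) → Xs , λ u v → trans (sym (foldr-cong Xs {o₁} {o₂} eq u v)) (trans (p u v) (eq′ u v)))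
      (λ (Xs , p) → Xs , λ u v → trans (foldr-cong Xs {o₁} {o₂} eq u v) (trans (p u v) (sym (eq′ u v))))
      (proj₂ (distance-exists o₁ o₁′)) (proj₂ (distance-exists o₂ o₂′))
    attained? : Decidable (IsInversionDistanceIn G)
    attained? d =
      searchOrientation
        (λ {o₁} {o₂} eq (o′ , p) → o′ , trans (sym (dist-cong {o₁} {o₂} {o′} {o′} eq (λ _ _ → refl))) p)
        λ o → searchOrientation
          (λ {o₁} {o₂} eq p → trans (sym (dist-cong {o} {o} {o₁} {o₂} (λ _ _ → refl) eq)) p)
          λ o′ → inversionDistance o o′ ≟ℕ d
    ub : ∀ {d} → IsInversionDistanceIn G d → d ≤ length (pairs {G = G})
    ub (o , o′ , refl) with bounded o o′
    ... | k , k≤ , reach = ≤-trans (proj₂ (proj₂ (distance-exists o o′)) reach) k≤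

diam : ∀ {n} → Graph n → ℕ
diam G = proj₁ (diam-exists G)

-- The subgraph of G induced by P. The vertices outside P are kept, as isolated
-- vertices; this does not affect being a forest or a star forest.
_[_] : ∀ {n} → Graph n → Pred (Fin n) 0ℓ → Rel (Fin n) 0ℓ
(G [ P ]) u v = P u × P v × Adjacent G u v

-- The cycle runs through the vertices in the listed order and back to the first.
record Cycle {V : Set} (_~_ : Rel V 0ℓ) : Set where
  field
    v₁ v₂ v₃ : V
    vs       : List V
    distinct : Unique (v₁ ∷ v₂ ∷ v₃ ∷ vs)
    closed   : Linked _~_ ((v₁ ∷ v₂ ∷ v₃ ∷ vs) ∷ʳ v₁)

Forest : ∀ {V : Set} → Rel V 0ℓ → Set
Forest _~_ = ¬ Cycle _~_

Component : ∀ {V : Set} → Rel V 0ℓ → V → Pred V 0ℓ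
Component _~_ v = Star _~_ v

-- For symmetric irreflexive _~_: its restriction to S is a K₁,ₜ with t ≥ 0.
IsStar : ∀ {V : Set} → Rel V 0ℓ → Pred V 0ℓ → Set
IsStar _~_ S = ∃ λ centre → S centre
  × (∀ u → S u → u ≢ centre → centre ~ u)
  × (∀ u w → S u → S w → u ~ w → u ≡ centre ⊎ w ≡ centre)

StarForest : ∀ {V : Set} → Rel V 0ℓ → Set
StarForest _~_ = Forest _~_ × (∀ v → IsStar _~_ (Component _~_ v))

InClasses : ∀ {n k} → (Fin n → Fin k) → Fin k → Fin k → Pred (Fin n) 0ℓ
InClasses c i j v = c v ≡ i ⊎ c v ≡ j

record IsColouring {n k : ℕ} (Good : Rel (Fin n) 0ℓ → Set)
                   (G : Graph n) (c : Fin n → Fin k) : Set where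
  field
    proper : ∀ u v → Adjacent G u v → c u ≢ c v
    good   : ∀ i j → i ≢ j → Good (G [ InClasses c i j ])

IsAcyclicColouring IsStarColouring : ∀ {n k} → Graph n → (Fin n → Fin k) → Set
IsAcyclicColouring = IsColouring Forest
IsStarColouring    = IsColouring StarForest

AcyclicallyColourable StarColourable : ∀ {n} → Graph n → Pred ℕ 0ℓ
AcyclicallyColourable G k = ∃ λ (c : Fin _ → Fin k) → IsAcyclicColouring G c
StarColourable        G k = ∃ λ (c : Fin _ → Fin k) → IsStarColouring G c

private
  open Cycle
  open IsColouring

  -- Local description of "the component of v is a star", used to decide it.
  LocalStar : ∀ {V : Set} → Rel V 0ℓ → V → Set
  LocalStar _~_ v = ∃ λ c → (v ≡ c ⊎ c ~ v) × (∀ u w → u ≡ c ⊎ c ~ u → u ~ w → u ≡ c ⊎ w ≡ c)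

  abstract
    cycle-map : ∀ {V} {R S : Rel V 0ℓ} → (∀ {u v} → R u v → S u v) → Cycle R → Cycle S
    cycle-map f C = record
      { v₁ = v₁ C ; v₂ = v₂ C ; v₃ = v₃ C ; vs = vs C
      ; distinct = distinct C ; closed = Linked.map f (closed C) }

    unique⇒injective : ∀ {V : Set} {xs : List V} → Unique xs → ∀ {i j} →
                       List.lookup xs i ≡ List.lookup xs j → i ≡ j
    unique⇒injective (_ ∷ _)   {zero}  {zero}  _  = refl
    unique⇒injective (ne ∷ _)  {zero}  {suc j} eq = contradiction eq (All.lookup ne (∈-lookup j))
    unique⇒injective (ne ∷ _)  {suc i} {zero}  eq = contradiction (sym eq) (All.lookup ne (∈-lookup i))
    unique⇒injective (_ ∷ un)  {suc i} {suc j} eq = cong suc (unique⇒injective un eq)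

    unique-length : ∀ {n} {xs : List (Fin n)} → Unique xs → length xs ≤ n
    unique-length un = injective⇒≤ (unique⇒injective un)

    cycle? : ∀ {n} {R : Rel (Fin n) 0ℓ} → B.Decidable R → Dec (Cycle R)
    cycle? {n} {R} R? = map′ to from
      (any? {n = n} λ k → any? λ x → any? λ y → any? λ z → searchVec any? (toℕ k) λ ws →
        DecUnique.unique? _≟_ (x ∷ y ∷ z ∷ toList ws) ×-dec linked? R? ((x ∷ y ∷ z ∷ toList ws) ∷ʳ x))
      where
      At : Fin n → Set
      At k = ∃ λ x → ∃ λ y → ∃ λ z → ∃ λ (ws : Vec (Fin n) (toℕ k)) →
        Unique (x ∷ y ∷ z ∷ toList ws) × Linked R ((x ∷ y ∷ z ∷ toList ws) ∷ʳ x)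
      to : ∃ At → Cycle R
      to (_ , x , y , z , ws , un , li) = record
        { v₁ = x ; v₂ = y ; v₃ = z ; vs = toList ws ; distinct = un ; closed = li }
      from : Cycle R → ∃ At
      from C = k , v₁ C , v₂ C , v₃ C , ws
             , subst (λ l → Unique (v₁ C ∷ v₂ C ∷ v₃ C ∷ l)) (sym ws≡) (distinct C)
             , subst (λ l → Linked R ((v₁ C ∷ v₂ C ∷ v₃ C ∷ l) ∷ʳ v₁ C)) (sym ws≡) (closed C)
        where
        l<n : length (vs C) < n
        l<n = ≤-trans (≤-trans (n≤1+n _) (n≤1+n _)) (unique-length (distinct C))
        k : Fin n
        k = fromℕ< l<n
        cast : ∀ {m} → m ≡ length (vs C) → ∃ λ (ws : Vec (Fin n) m) → toList ws ≡ vs C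
        cast refl = fromList (vs C) , toList∘fromList (vs C)
        found : ∃ λ (ws : Vec (Fin n) (toℕ k)) → toList ws ≡ vs C
        found = cast (toℕ-fromℕ< l<n)
        ws : Vec (Fin n) (toℕ k)
        ws = proj₁ found
        ws≡ : toList ws ≡ vs C
        ws≡ = proj₂ found

    local⇒star : ∀ {V} {R : Rel V 0ℓ} → Symmetric R → ∀ {v} → LocalStar R v → IsStar R (Component R v)
    local⇒star {V} {R} symR {v} (c , v∈ , cl) =
      c , Sum.[ (λ { refl → ε }) , (λ r → symR r ◅ ε) ] v∈
        , (λ u S u≢c → case near v∈ S of λ { (inj₁ eq) → contradiction eq u≢c ; (inj₂ r) → r })
        , λ u w S _ → cl u w (near v∈ S)
      where
      near : ∀ {x u} → x ≡ c ⊎ R c x → Star R x u → u ≡ c ⊎ R c u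
      near x∈ ε = x∈
      near {x} x∈ (_◅_ {j = y} r rs) with cl x y x∈ r
      ... | inj₁ refl = near (inj₂ r) rs
      ... | inj₂ refl = near (inj₁ refl) rs

    star⇒local : ∀ {n} {R : Rel (Fin n) 0ℓ} → Symmetric R →
                 ∀ {v} → IsStar R (Component R v) → LocalStar R v
    star⇒local {R = R} symR {v} (c , Sc , all , cl) = c , v∈ , λ u w u∈ r →
        cl u w (S u∈) (S u∈ ◅◅ (r ◅ ε)) r
      where
      v∈ : v ≡ c ⊎ R c v
      v∈ with v ≟ c
      ... | yes eq = inj₁ eq
      ... | no ne  = inj₂ (all v ε ne)
      S : ∀ {u} → u ≡ c ⊎ R c u → Star R v u
      S (inj₁ refl) = Sc
      S (inj₂ r)    = Sc ◅◅ (r ◅ ε)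

    localStar? : ∀ {n} {R : Rel (Fin n) 0ℓ} → B.Decidable R → Decidable (LocalStar R)
    localStar? R? v = any? λ c → ((v ≟ c) ⊎-dec R? c v) ×-dec
      all? λ u → all? λ w → ((u ≟ c) ⊎-dec R? c u) →-dec (R? u w →-dec ((u ≟ c) ⊎-dec (w ≟ c)))

    forest? : ∀ {n} {R : Rel (Fin n) 0ℓ} → Symmetric R → B.Decidable R → Dec (Forest R)
    forest? _ R? = ¬? (cycle? R?)

    starForest? : ∀ {n} {R : Rel (Fin n) 0ℓ} → Symmetric R → B.Decidable R → Dec (StarForest R)
    starForest? symR R? = ¬? (cycle? R?) ×-dec
      map′ (λ f v → local⇒star symR (f v)) (λ f v → star⇒local symR (f v)) (all? (localStar? R?))

    forest-resp : ∀ {n} {R S : Rel (Fin n) 0ℓ} → Symmetric R → Symmetric S →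
                  (∀ {u v} → R u v → S u v) → (∀ {u v} → S u v → R u v) → Forest R → Forest S
    forest-resp _ _ f g ¬C C = ¬C (cycle-map g C)

    starForest-resp : ∀ {n} {R S : Rel (Fin n) 0ℓ} → Symmetric R → Symmetric S →
                      (∀ {u v} → R u v → S u v) → (∀ {u v} → S u v → R u v) → StarForest R → StarForest S
    starForest-resp symR symS f g (¬C , st) = (λ C → ¬C (cycle-map g C)) , λ v →
      case star⇒local symR (st v) of λ (c , v∈ , cl) →
        local⇒star symS (c , Sum.map₂ f v∈ , λ u w u∈ s → cl u w (Sum.map₂ g u∈) (g s))

    induced-sym : ∀ {n} (G : Graph n) P → Symmetric (G [ P ])
    induced-sym G P {u} {v} (p , q , e) = q , p , subst T (symmetric G u v) e

    two-values : ∀ {A : Set} {i j x y z : A} → x ≡ i ⊎ x ≡ j → y ≡ i ⊎ y ≡ j → z ≡ i ⊎ z ≡ j →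
                 x ≢ y → x ≢ z → y ≢ z → ⊥
    two-values (inj₁ refl) (inj₁ refl) _ x≢y _ _ = x≢y refl
    two-values (inj₂ refl) (inj₂ refl) _ x≢y _ _ = x≢y refl
    two-values (inj₁ refl) (inj₂ refl) (inj₁ refl) _ x≢z _ = x≢z refl
    two-values (inj₁ refl) (inj₂ refl) (inj₂ refl) _ _ y≢z = y≢z refl
    two-values (inj₂ refl) (inj₁ refl) (inj₁ refl) _ _ y≢z = y≢z refl
    two-values (inj₂ refl) (inj₁ refl) (inj₂ refl) _ x≢z _ = x≢z refl

    id-forest : ∀ {n} (G : Graph n) i j → Forest (G [ InClasses id i j ])
    id-forest G i j C with distinct C | closed C
    ... | (v₁≢v₂ ∷ v₁≢v₃ ∷ _) ∷ (v₂≢v₃ ∷ _) ∷ _ | (p₁ , p₂ , _) ∷ (_ , p₃ , _) ∷ _ =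
      two-values p₁ p₂ p₃ v₁≢v₂ v₁≢v₃ v₂≢v₃

    adjacent⇒≢ : ∀ {n} (G : Graph n) {u v} → Adjacent G u v → u ≢ v
    adjacent⇒≢ G {u} e refl = subst T (irreflexive G u) e

    id-localStar : ∀ {n} (G : Graph n) i j v → LocalStar (G [ InClasses id i j ]) v
    id-localStar G i j v = v , inj₁ refl , covered
      where
      covered : ∀ u w → u ≡ v ⊎ (G [ InClasses id i j ]) v u → (G [ InClasses id i j ]) u w →
                u ≡ v ⊎ w ≡ v
      covered u w (inj₁ eq) _ = inj₁ eq
      covered u w (inj₂ (pv , pu , vu)) (_ , pw , uw) with w ≟ v
      ... | yes eq = inj₂ eq
      ... | no w≢v =
        ⊥-elim (two-values pv pu pw (adjacent⇒≢ G vu) (w≢v ∘ sym) (adjacent⇒≢ G uw))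

    id-proper : ∀ {n} (G : Graph n) u v → Adjacent G u v → u ≢ v
    id-proper G u v = adjacent⇒≢ G

    colouring? : ∀ {n} {Good : Rel (Fin n) 0ℓ → Set} →
      (∀ {R : Rel (Fin n) 0ℓ} → Symmetric R → B.Decidable R → Dec (Good R)) →
      (∀ {R S : Rel (Fin n) 0ℓ} → Symmetric R → Symmetric S →
        (∀ {u v} → R u v → S u v) → (∀ {u v} → S u v → R u v) → Good R → Good S) →
      ∀ (G : Graph n) k → Dec (∃ λ (c : Fin n → Fin k) → IsColouring Good G c)
    colouring? {n} {Good} dec resp G k =
      map′ (λ (cs , p) → lookup cs , p) (λ (c , p) → tabulate c , transport c p)
        (searchVec any? n λ cs → isColouring? (lookup cs))
      where
      adj? : B.Decidable (Adjacent G)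
      adj? u v = T? (edge G u v)
      in? : ∀ (c : Fin n → Fin k) i j → Decidable (InClasses c i j)
      in? c i j v = (c v ≟ i) ⊎-dec (c v ≟ j)
      isColouring? : (c : Fin n → Fin k) → Dec (IsColouring Good G c)
      isColouring? c = map′ (λ (p , g) → record { proper = p ; good = g }) (λ p → proper p , good p)
        ((all? λ u → all? λ v → adj? u v →-dec ¬? (c u ≟ c v)) ×-dec
         (all? λ i → all? λ j → ¬? (i ≟ j) →-dec
           dec {G [ InClasses c i j ]} (λ {u} {v} → induced-sym G (InClasses c i j) {u} {v})
               λ u v → in? c i j u ×-dec (in? c i j v ×-dec adj? u v)))
      transport : (c : Fin n → Fin k) → IsColouring Good G c → IsColouring Good G (lookup (tabulate c))
      transport c p = record
        { proper = λ u v e eq → proper p u v e (trans (sym (same u)) (trans eq (same v)))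
        ; good = λ i j i≢j → resp {G [ InClasses c i j ]} {G [ InClasses (lookup (tabulate c)) i j ]}
            (λ {u} {v} → induced-sym G (InClasses c i j) {u} {v})
            (λ {u} {v} → induced-sym G (InClasses (lookup (tabulate c)) i j) {u} {v})
            (λ {u} {v} (a , b , e) → Sum.map (trans (same u)) (trans (same u)) a
                                   , Sum.map (trans (same v)) (trans (same v)) b , e)
            (λ {u} {v} (a , b , e) → Sum.map (trans (sym (same u))) (trans (sym (same u))) a
                                   , Sum.map (trans (sym (same v))) (trans (sym (same v))) b , e)
            (good p i j i≢j) }
        where
        same : ∀ v → lookup (tabulate c) v ≡ c v
        same = lookup∘tabulate c

abstract
  χₐ-exists : ∀ {n} (G : Graph n) → ∃ (IsLeast (AcyclicallyColourable G))
  χₐ-exists {n} G = least (colouring? forest? forest-resp G)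
    (n , id , record { proper = id-proper G ; good = λ i j _ → id-forest G i j })

  χₛ-exists : ∀ {n} (G : Graph n) → ∃ (IsLeast (StarColourable G))
  χₛ-exists {n} G = least (colouring? starForest? starForest-resp G)
    (n , id , record
      { proper = id-proper G
      ; good = λ i j _ → id-forest G i j , λ v →
          local⇒star (λ {u} {w} → induced-sym G (InClasses id i j) {u} {w}) (id-localStar G i j v) })

χₐ χₛ : ∀ {n} → Graph n → ℕ
χₐ G = proj₁ (χₐ-exists G)
χₛ G = proj₁ (χₛ-exists G)

{-# OPTIONS --safe #-}
module Submission where

-- Two orientations are t inversions apart iff the vertices carry labels in F₂ᵗ whose inner
-- product on each edge tells whether the orientations disagree there. Given an acyclic
-- colouring c, assign to each colour l a block F₂²: vertices of colour l get (1,0) there,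
-- any other vertex u gets (F u l, F u l). The inner product on an edge uv is then
-- F u (c v) + F v (c u). For fixed colours i, j this is a sum of values of one function at
-- the two ends of an edge of the forest induced by colours i and j, so it can be prescribed.
-- One block can be shortened to F₂, since the resulting products on edges avoiding its colour
-- can be compensated; this gives 2k - 1 ≤ 4k - 7 for k ≥ 3 colours.

open import Defs
open import Algebra.Bundles using (CommutativeRing)
import Algebra.Properties.CommutativeMonoid.Sum as Sums
open import Data.Bool using (Bool; true; false; not; T; _∧_; _∨_; _xor_; if_then_else_)
open import Data.Bool.Properties
  using (T?; ∧-comm; ∧-identityʳ; xor-assoc; xor-comm; xor-same; xor-identityʳ;
         xor-∧-commutativeRing)
open import Data.Empty using (⊥-elim)
open import Data.Fin using (Fin; zero; suc; punchIn; punchOut; _≟_)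
open import Data.Fin.Properties
  using (punchInᵢ≢i; punchIn-injective; punchIn-punchOut; suc-injective; <-cmp; _<?_)
open import Data.Fin.Subset using (Subset)
open import Data.Fin.Subset.Properties using (_∈?_)
open import Data.List using (List; []; _∷_; _∷ʳ_; cartesianProduct; allFin)
open import Data.List.Membership.Propositional using (_∈_)
open import Data.List.Membership.Propositional.Properties
  using (∈-cartesianProduct⁺; ∈-allFin; ∈-filter⁺)
open import Data.List.Relation.Unary.All using (All; []; _∷_)
import Data.List.Relation.Unary.All as All
open import Data.List.Relation.Unary.All.Properties using (¬Any⇒All¬; all-filter)
open import Data.List.Relation.Unary.AllPairs using ([]; _∷_)
open import Data.List.Relation.Unary.Any using (here; there)
import Data.List.Membership.DecPropositional as DecMembership
open import Data.List.Relation.Unary.Linked using (Linked; [-]; _∷_)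
open import Data.List.Relation.Unary.Unique.Propositional using (Unique)
open import Data.Nat using (ℕ; zero; suc; _+_; _*_; _∸_; _⊔_; _≤_; z≤n)
open import Data.Nat.Properties
  using (≤-trans; ≤-reflexive; m≤m⊔n; m≤m+n; ⊔-monoˡ-≤; ∸-monoˡ-≤; *-monoʳ-≤; m+n∸n≡m)
open import Data.Nat.Tactic.RingSolver using (solve-∀)
open import Data.Product using (∃; _×_; _,_; proj₁; proj₂)
open import Data.Sum using (inj₁; inj₂)
open import Data.Vec using (Vec; []; _∷_; lookup; tabulate; foldr′; map)
open import Data.Vec.Functional using (removeAt)
open import Data.Vec.Properties using (lookup∘tabulate)
open import Function using (_∘_)
open import Level using (0ℓ)
open import Relation.Binary using (Rel; Symmetric; tri<; tri≈; tri>)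
import Relation.Binary as B
open import Relation.Binary.Construct.Closure.Equivalence using (EqClosure)
import Relation.Binary.Construct.Closure.Equivalence as Eq
open import Relation.Binary.Construct.Closure.ReflexiveTransitive using (Star; ε; _◅_; _◅◅_)
open import Relation.Binary.Construct.Closure.Symmetric using (SymClosure; fwd; bwd)
open import Relation.Binary.PropositionalEquality
  using (_≡_; _≢_; refl; sym; trans; cong; cong₂; subst; module ≡-Reasoning)
open import Relation.Nullary using (¬_; Dec; yes; no; does; contradiction)
open import Relation.Nullary.Decidable using (_×-dec_; _⊎-dec_; dec-true; dec-false)

open Graph using (edge; Adjacent; symmetric; irreflexive)
open Orientation using (arc; underlying; oneWay)
open Sums (CommutativeRing.+-commutativeMonoid xor-∧-commutativeRing)
  using (sum; sum-remove; sum-cong-≗; sum-replicate-zero)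

-- Simple paths, and closing them to cycles.

data Walk {V : Set} (_~_ : Rel V 0ℓ) : V → List V → V → Set where
  stop : ∀ {x} → Walk _~_ x [] x
  step : ∀ {x y z ys} → x ~ y → Walk _~_ y ys z → Walk _~_ x (y ∷ ys) z

SimplePath : {V : Set} → Rel V 0ℓ → Rel V 0ℓ
SimplePath {V} _~_ x z = ∃ λ (xs : List V) → Walk _~_ x xs z × Unique (x ∷ xs)

module _ {n : ℕ} {_~_ : Rel (Fin n) 0ℓ} where

  open DecMembership (_≟_ {n}) using () renaming (_∈?_ to _∈ᴸ?_)

  cut : ∀ {x y z ys} → x ∈ (y ∷ ys) → Walk _~_ y ys z → Unique (y ∷ ys) → SimplePath _~_ x z
  cut (here refl) walk          un       = _ , walk , un
  cut (there x∈)  (step _ walk) (_ ∷ un) = cut x∈ walk un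

  -- A vertex prepended to a simple path either is new or already occurs on it; in the second case
  -- the suffix starting there is taken instead.
  star⇒simplePath : ∀ {x z} → Star _~_ x z → SimplePath _~_ x z
  star⇒simplePath ε = [] , stop , [] ∷ []
  star⇒simplePath {x} (_◅_ {j = y} x~y y~*z) with star⇒simplePath y~*z
  ... | ys , walk , un with x ∈ᴸ? (y ∷ ys)
  ...   | yes x∈ = cut x∈ walk un
  ...   | no x∉  = y ∷ ys , step x~y walk , ¬Any⇒All¬ _ x∉ ∷ un

-- Two relations are kept apart because a path through edges inserted so far is closed by an edge
-- that need not be among them.
closeWalk : ∀ {V : Set} {_~_ _≈ᴿ_ : Rel V 0ℓ} → (∀ {x y} → x ~ y → x ≈ᴿ y) →
            ∀ {x xs z t} → Walk _~_ x xs z → z ≈ᴿ t → Linked _≈ᴿ_ ((x ∷ xs) ∷ʳ t)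
closeWalk f stop            z≈t = z≈t ∷ [-]
closeWalk f (step x~y walk) z≈t = f x~y ∷ closeWalk f walk z≈t

-- Identities in F₂.

xor-cancelˡ : ∀ a b → a xor (a xor b) ≡ b
xor-cancelˡ a b = trans (sym (xor-assoc a a b)) (cong (_xor b) (xor-same a))

xor-shift : ∀ d a b → (d xor a) xor (d xor b) ≡ a xor b
xor-shift false a     b = refl
xor-shift true  false b = xor-cancelˡ true b
xor-shift true  true  b = refl

-- `(a xor b) xor c` is the defect of an edge with end values `a`, `b` and prescribed sum `c`;
-- adding it at one end repairs the edge.
xor-correction : ∀ a b c → a xor (((a xor b) xor c) xor b) ≡ c
xor-correction false false c     = xor-identityʳ c
xor-correction true  true  c     = trans (cong not (xor-comm c true)) (xor-cancelˡ true c)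
xor-correction false true  false = refl
xor-correction false true  true  = refl
xor-correction true  false false = refl
xor-correction true  false true  = refl

-- Prescribing edge sums on a forest.

-- Edges are inserted one at a time. An edge between two components can be balanced by
-- flipping f on one of them; an edge within a component closes a cycle, or is a repetition.
module ForestPotential {n : ℕ} {_~_ : Rel (Fin n) 0ℓ}
  (~-sym : Symmetric _~_) (~-irrefl : ∀ {x} → ¬ x ~ x) (forest : Forest _~_)
  (w : Fin n → Fin n → Bool) (w-sym : ∀ x y → w x y ≡ w y x) where

  -- `component` labels the connected components of the listed edges, so that connectivity is
  -- decided by comparing labels.
  record Potential (L : List (Fin n × Fin n)) : Set where
    Listed : Rel (Fin n) 0ℓ
    Listed x y = (x , y) ∈ L
    field
      f         : Fin n → Bool
      component : Fin n → Fin n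
      balanced  : ∀ {x y} → Listed x y → f x xor f y ≡ w x y
      joined    : ∀ {x y} → Listed x y → component x ≡ component y
      connected : ∀ x y → component x ≡ component y → EqClosure Listed x y

  module _ {L : List (Fin n × Fin n)} (L⊆ : All (λ (x , y) → x ~ y) L) (P : Potential L)
           {u v : Fin n} (u~v : u ~ v) where

    open Potential P

    sound : ∀ {x y} → SymClosure Listed x y → x ~ y
    sound (fwd xy∈) = All.lookup L⊆ xy∈
    sound (bwd yx∈) = ~-sym (All.lookup L⊆ yx∈)

    balanced-sym : ∀ {x y} → SymClosure Listed x y → f x xor f y ≡ w x y
    balanced-sym (fwd xy∈) = balanced xy∈
    balanced-sym (bwd yx∈) = trans (xor-comm (f _) (f _)) (trans (balanced yx∈) (w-sym _ _))

    -- The list used in `potential` has each edge in both directions; the second copy meets a path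
    -- of one step. A longer simple path would close to a cycle.
    repeated : SimplePath (SymClosure Listed) u v → f u xor f v ≡ w u v
    repeated (_ , stop , _)          = contradiction u~v ~-irrefl
    repeated (_ , step e stop , _)   = balanced-sym e
    repeated (_ , walk@(step _ (step _ _)) , un) = contradiction (record
      { distinct = un ; closed = closeWalk sound walk (~-sym u~v) }) forest

    insertWithin : component u ≡ component v → Potential ((u , v) ∷ L)
    insertWithin ru≡rv = record
      { f         = f
      ; component = component
      ; balanced  = λ where
          (here refl) → repeated (star⇒simplePath (connected u v ru≡rv))
          (there xy∈) → balanced xy∈
      ; joined    = λ where
          (here refl) → ru≡rv
          (there xy∈) → joined xy∈
      ; connected = λ x y → Eq.map there ∘ connected x y
      }

    insertBetween : component u ≢ component v → Potential ((u , v) ∷ L)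
    insertBetween ru≢rv = record
      { f = f′ ; component = component′
      ; balanced = balanced′ ; joined = joined′ ; connected = connected′ }
      where
      δ : Bool
      δ = (f u xor f v) xor w u v

      f′ : Fin n → Bool
      f′ x = if does (component x ≟ component v) then δ xor f x else f x

      component′ : Fin n → Fin n
      component′ x = if does (component x ≟ component v) then component u else component x

      balanced′ : ∀ {x y} → (x , y) ∈ ((u , v) ∷ L) → f′ x xor f′ y ≡ w x y
      balanced′ (here refl) with component u ≟ component v | component v ≟ component v
      ... | yes ru≡rv | _       = contradiction ru≡rv ru≢rv
      ... | no _      | yes _   = xor-correction (f u) (f v) (w u v)
      ... | no _      | no rv≢rv = contradiction refl rv≢rv
      balanced′ {x} {y} (there xy∈) rewrite joined xy∈ with component y ≟ component v
      -- The ends of an old edge share a component, so both are shifted or neither is.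
      ... | yes _ = trans (xor-shift δ (f x) (f y)) (balanced xy∈)
      ... | no _  = balanced xy∈

      joined′ : ∀ {x y} → (x , y) ∈ ((u , v) ∷ L) → component′ x ≡ component′ y
      joined′ (here refl) with component u ≟ component v | component v ≟ component v
      ... | yes _ | yes _    = refl
      ... | no _  | yes _    = refl
      ... | _     | no rv≢rv = contradiction refl rv≢rv
      joined′ (there xy∈) rewrite joined xy∈ = refl

      lift : ∀ x y → component x ≡ component y → EqClosure (λ x y → (x , y) ∈ ((u , v) ∷ L)) x y
      lift x y = Eq.map there ∘ connected x y

      connected′ : ∀ x y → component′ x ≡ component′ y →
                   EqClosure (λ x y → (x , y) ∈ ((u , v) ∷ L)) x y
      connected′ x y eq with component x ≟ component v | component y ≟ component v
      ... | yes rx≡rv | yes ry≡rv = lift x y (trans rx≡rv (sym ry≡rv))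
      ... | yes rx≡rv | no _      = lift x v rx≡rv ◅◅ (bwd (here refl) ◅ lift u y eq)
      ... | no _      | yes ry≡rv = lift x u eq ◅◅ (fwd (here refl) ◅ lift v y (sym ry≡rv))
      ... | no _      | no _      = lift x y eq

    insert : Potential ((u , v) ∷ L)
    insert with component u ≟ component v
    ... | yes ru≡rv = insertWithin ru≡rv
    ... | no ru≢rv  = insertBetween ru≢rv

  fromList : ∀ {L} → All (λ (x , y) → x ~ y) L → Potential L
  fromList [] = record
    { f = λ _ → false ; component = λ x → x ; balanced = λ () ; joined = λ ()
    ; connected = λ { _ _ refl → ε } }
  fromList (u~v ∷ L⊆) = insert L⊆ (fromList L⊆) u~v

  potential : B.Decidable _~_ → ∃ λ (f : Fin n → Bool) → ∀ {x y} → x ~ y → f x xor f y ≡ w x y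
  potential _~?_ = f , λ {x} {y} x~y →
      balanced (∈-filter⁺ R? (∈-cartesianProduct⁺ (∈-allFin x) (∈-allFin y)) x~y)
    where
    R? : ∀ ((x , y) : Fin n × Fin n) → Dec (x ~ y)
    R? (x , y) = x ~? y
    open Potential (fromList (all-filter R? (cartesianProduct (allFin n) (allFin n))))

-- Potentials from an acyclic colouring.

module _ {n : ℕ} {G : Graph n} where

  adjacent-sym : ∀ {u v} → Adjacent G u v → Adjacent G v u
  adjacent-sym {u} {v} = subst T (symmetric G u v)

  adjacent-irrefl : ∀ {v} → ¬ Adjacent G v v
  adjacent-irrefl {v} = subst T (irreflexive G v)

  -- The weight is arbitrary because two are needed: the disagreement of the orientations, and its
  -- correction by the shortened block.
  colourPotential : ∀ {k} {c : Fin n → Fin k} → IsAcyclicColouring G c →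
    ∀ {w : Fin n → Fin n → Bool} → (∀ u v → w u v ≡ w v u) →
    ∃ λ (F : Fin n → Fin k → Bool) → ∀ {u v} → Adjacent G u v →
      F u (c v) xor F v (c u) ≡ w u v
  colourPotential {k} {c} colouring {w} w-sym = F , F-balanced
    where
    open IsColouring colouring

    pairPotential : ∀ i j → ∃ λ (f : Fin n → Bool) → i ≢ j →
      ∀ {u v} → (G [ InClasses c i j ]) u v → f u xor f v ≡ w u v
    pairPotential i j with i ≟ j
    -- A placeholder: the ends of an edge never have equal colours.
    ... | yes i≡j = (λ _ → false) , contradiction i≡j
    ... | no i≢j  = let f , balanced = solution in f , λ _ → balanced
      where
      in? : ∀ v → Dec (InClasses c i j v)
      in? v = (c v ≟ i) ⊎-dec (c v ≟ j)

      solution : ∃ λ (f : Fin n → Bool) → ∀ {u v} → (G [ InClasses c i j ]) u v → f u xor f v ≡ w u v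
      solution = ForestPotential.potential
        (λ (p , q , e) → q , p , adjacent-sym e) (λ (_ , _ , e) → adjacent-irrefl e)
        (good i j i≢j) w w-sym (λ u v → in? u ×-dec (in? v ×-dec T? (edge G u v)))

    -- Both orders of a pair of colours must yield the same potential.
    pot : Fin k → Fin k → Fin n → Bool
    pot i j = if does (i <? j) then proj₁ (pairPotential i j) else proj₁ (pairPotential j i)

    pot-balanced : ∀ {u v i j} → c u ≡ i → c v ≡ j → i ≢ j → Adjacent G u v →
                   pot i j u xor pot j i v ≡ w u v
    pot-balanced {i = i} {j} cu≡i cv≡j i≢j e with <-cmp i j
    ... | tri< i<j _ j≮i rewrite dec-true (i <? j) i<j | dec-false (j <? i) j≮i =
      proj₂ (pairPotential i j) i≢j (inj₁ cu≡i , inj₂ cv≡j , e)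
    ... | tri≈ _ i≡j _ = contradiction i≡j i≢j
    ... | tri> i≮j _ j<i rewrite dec-true (j <? i) j<i | dec-false (i <? j) i≮j =
      proj₂ (pairPotential j i) (i≢j ∘ sym) (inj₂ cu≡i , inj₁ cv≡j , e)

    F : Fin n → Fin k → Bool
    F u j = pot (c u) j u

    F-balanced : ∀ {u v} → Adjacent G u v → F u (c v) xor F v (c u) ≡ w u v
    F-balanced {u} {v} e = pot-balanced refl refl (proper u v e) e

-- Sums over F₂ supported on one or two indices.

sum-single : ∀ {m} (t : Fin m → Bool) i → (∀ l → l ≢ i → t l ≡ false) → sum t ≡ t i
sum-single {suc m} t i zeros = begin
  sum t                          ≡⟨ sum-remove {i = i} t ⟩
  t i xor sum (removeAt t i)     ≡⟨ cong (t i xor_)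
    (sum-cong-≗ λ l → zeros (punchIn i l) (punchInᵢ≢i i l)) ⟩
  t i xor sum {m} (λ _ → false)  ≡⟨ cong (t i xor_) (sum-replicate-zero m) ⟩
  t i xor false                  ≡⟨ xor-identityʳ (t i) ⟩
  t i                            ∎
  where open ≡-Reasoning

sum-pair : ∀ {m} (t : Fin m → Bool) {i j} → i ≢ j → (∀ l → l ≢ i → l ≢ j → t l ≡ false) →
           sum t ≡ t i xor t j
sum-pair {suc m} t {i} {j} i≢j zeros = begin
  sum t                                 ≡⟨ sum-remove {i = i} t ⟩
  t i xor sum (removeAt t i)            ≡⟨ cong (t i xor_)
    (sum-single (removeAt t i) (punchOut i≢j) zeros′) ⟩
  t i xor t (punchIn i (punchOut i≢j))  ≡⟨ cong (λ l → t i xor t l) (punchIn-punchOut i≢j) ⟩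
  t i xor t j                           ∎
  where
  open ≡-Reasoning
  zeros′ : ∀ l → l ≢ punchOut i≢j → t (punchIn i l) ≡ false
  zeros′ l l≢ = zeros (punchIn i l) (punchInᵢ≢i i l)
    λ eq → l≢ (punchIn-injective i l (punchOut i≢j) (trans eq (sym (punchIn-punchOut i≢j))))

-- Inversions as vector labellings.

-- A family of t sets, given by their indicator functions, is read as a labelling of the
-- vertices by vectors of F₂ᵗ; the inner product of the labels of u and v counts modulo 2
-- the inversions that act on uv.
inner : ∀ {n t} → Vec (Fin n → Bool) t → Fin n → Fin n → Bool
inner []       u v = false
inner (p ∷ ps) u v = (p u ∧ p v) xor inner ps u v

inner-comm : ∀ {n t} (ps : Vec (Fin n → Bool) t) u v → inner ps u v ≡ inner ps v u
inner-comm []       u v = refl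
inner-comm (p ∷ ps) u v = cong₂ _xor_ (∧-comm (p u) (p v)) (inner-comm ps u v)

does-∈? : ∀ {n} (u : Fin n) (X : Subset n) → does (u ∈? X) ≡ lookup X u
does-∈? zero    (true  ∷ X) = refl
does-∈? zero    (false ∷ X) = refl
does-∈? (suc u) (_ ∷ X)     = does-∈? u X

does-∈?-tabulate : ∀ {n} (u : Fin n) (p : Fin n → Bool) → does (u ∈? tabulate p) ≡ p u
does-∈?-tabulate u p = trans (does-∈? u (tabulate p)) (lookup∘tabulate p u)

module _ {n : ℕ} {G : Graph n} where

  arc-invertAll : ∀ {t} (ps : Vec (Fin n → Bool) t) (o : Orientation G) u v →
    arc (foldr′ invert o (map tabulate ps)) u v ≡ (if inner ps u v then arc o v u else arc o u v)
  arc-invertAll []       o u v = refl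
  -- An inversion acting on `uv` swaps its arcs, so the induction hypothesis is used for `uv` and
  -- `vu`; `inner-comm` gives both the same parity.
  arc-invertAll (p ∷ ps) o u v
    rewrite does-∈?-tabulate u p | does-∈?-tabulate v p
          | arc-invertAll ps o u v | arc-invertAll ps o v u | inner-comm ps v u
    with p u ∧ p v | inner ps u v
  ... | true  | true  = refl
  ... | true  | false = refl
  ... | false | _     = refl

  disagreement : Orientation G → Orientation G → Fin n → Fin n → Bool
  disagreement o o′ u v = arc o u v xor arc o′ u v

  -- Exchanging the ends of an edge negates its arc value in both orientations; on non-edges all
  -- values are `false`.
  disagreement-sym : ∀ o o′ u v → disagreement o o′ u v ≡ disagreement o o′ v u
  disagreement-sym o o′ u v
    with arc o u v | arc o v u | arc o′ u v | arc o′ v u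
       | oneWay o u v | oneWay o′ u v | trans (underlying o u v) (sym (underlying o′ u v))
  ... | true  | false | true  | false | _ | _ | _ = refl
  ... | true  | false | false | true  | _ | _ | _ = refl
  ... | false | true  | true  | false | _ | _ | _ = refl
  ... | false | true  | false | true  | _ | _ | _ = refl
  ... | false | false | false | false | _ | _ | _ = refl

  private
    -- On a non-edge both arcs are absent, so swapping them changes nothing. On an edge `b` is the
    -- negation of `a`, and swapping exactly when `a` and `a′` differ yields `a′`.
    resolve : ∀ {e a b a′ b′ d} → a ∨ b ≡ e → a ∧ b ≡ false → a′ ∨ b′ ≡ e →
              (T e → d ≡ a xor a′) → (if d then b else a) ≡ a′
    resolve {false} {false} {false} {false} {false} {true}  _ _ _ _ = refl
    resolve {false} {false} {false} {false} {false} {false} _ _ _ _ = refl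
    resolve {true} {true}  {false} {true}  _ _ _ d≡ rewrite d≡ _ = refl
    resolve {true} {true}  {false} {false} _ _ _ d≡ rewrite d≡ _ = refl
    resolve {true} {false} {true}  {true}  _ _ _ d≡ rewrite d≡ _ = refl
    resolve {true} {false} {true}  {false} _ _ _ d≡ rewrite d≡ _ = refl

  transforms : ∀ {t} (ps : Vec (Fin n → Bool) t) o o′ →
    (∀ {u v} → Adjacent G u v → inner ps u v ≡ disagreement o o′ u v) → InvertibleIn o o′ t
  transforms ps o o′ labels = map tabulate ps , λ u v →
    trans (arc-invertAll ps o u v) (agree u v)
    where
    agree : ∀ u v → (if inner ps u v then arc o v u else arc o u v) ≡ arc o′ u v
    agree u v = resolve (underlying o u v) (oneWay o u v) (underlying o′ u v) labels

  diam≤ : ∀ {t} → (∀ (o o′ : Orientation G) → InvertibleIn o o′ t) → diam G ≤ t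
  diam≤ reach with proj₁ (proj₂ (diam-exists G))
  ... | o , o′ , attained =
    ≤-trans (≤-reflexive (sym attained)) (proj₂ (proj₂ (distance-exists o o′)) (reach o o′))

-- Labels built from the colour blocks.

-- Block l of the labels: colour l receives (1,0) and every other colour a multiple of the
-- isotropic vector (1,1), so that block l vanishes on edges avoiding colour l.
module Block {n k : ℕ} (c : Fin n → Fin k) (F : Fin n → Fin k → Bool) where

  p q : Fin k → Fin n → Bool
  p l u = if does (c u ≟ l) then true  else F u l
  q l u = if does (c u ≟ l) then false else F u l

  term : Fin n → Fin n → Fin k → Bool
  term u v l = (p l u ∧ p l v) xor (q l u ∧ q l v)

  term-off : ∀ {u v l} → c u ≢ l → c v ≢ l → term u v l ≡ false
  term-off {u} {v} {l} cu≢l cv≢l with c u ≟ l | c v ≟ l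
  ... | yes cu≡l | _        = contradiction cu≡l cu≢l
  ... | no _     | yes cv≡l = contradiction cv≡l cv≢l
  ... | no _     | no _     = xor-same (F u l ∧ F v l)

  term-left : ∀ {u v l} → c u ≡ l → c v ≢ l → term u v l ≡ F v l
  term-left {u} {v} {l} cu≡l cv≢l with c u ≟ l | c v ≟ l
  ... | no cu≢l | _        = contradiction cu≡l cu≢l
  ... | yes _   | yes cv≡l = contradiction cv≡l cv≢l
  ... | yes _   | no _     = xor-identityʳ (F v l)

  term-right : ∀ {u v l} → c u ≢ l → c v ≡ l → term u v l ≡ F u l
  term-right {u} {v} {l} cu≢l cv≡l = trans
    (cong₂ _xor_ (∧-comm (p l u) (p l v)) (∧-comm (q l u) (q l v))) (term-left cv≡l cu≢l)

-- With two colours no edge avoids either colour, so both blocks can be shortened to F₂.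
twoLabels : ∀ {n} → (Fin n → Fin 2) → (Fin n → Fin 2 → Bool) → Vec (Fin n → Bool) 2
twoLabels c F = label zero ∷ label (suc zero) ∷ []
  where
  label : Fin 2 → Fin _ → Bool
  label l u = if does (c u ≟ l) then true else F u l

inner-twoLabels : ∀ {n} (c : Fin n → Fin 2) F {u v} → c u ≢ c v →
                  inner (twoLabels c F) u v ≡ F u (c v) xor F v (c u)
inner-twoLabels c F {u} {v} cu≢cv with c u | c v
... | zero     | zero     = contradiction refl cu≢cv
... | suc zero | suc zero = contradiction refl cu≢cv
... | zero     | suc zero = trans
  (cong (F v zero xor_) (trans (xor-identityʳ (F u (suc zero) ∧ true)) (∧-identityʳ (F u (suc zero)))))
  (xor-comm (F v zero) (F u (suc zero)))
... | suc zero | zero     =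
  cong₂ _xor_ (∧-identityʳ (F u zero)) (xor-identityʳ (F v (suc zero)))

-- Alternating the coordinates lets each recursion step handle one whole block.
interleave : ∀ {n m} → (Fin m → Fin n → Bool) → (Fin m → Fin n → Bool) →
             Vec (Fin n → Bool) (m * 2)
interleave {m = zero}  p q = []
interleave {m = suc m} p q = p zero ∷ q zero ∷ interleave (p ∘ suc) (q ∘ suc)

inner-interleave : ∀ {n m} (p q : Fin m → Fin n → Bool) u v →
  inner (interleave p q) u v ≡ sum (λ l → (p l u ∧ p l v) xor (q l u ∧ q l v))
inner-interleave {m = zero}  p q u v = refl
inner-interleave {m = suc m} p q u v = trans
  (sym (xor-assoc (p zero u ∧ p zero v) _ _))
  (cong (((p zero u ∧ p zero v) xor (q zero u ∧ q zero v)) xor_)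
        (inner-interleave (p ∘ suc) (q ∘ suc) u v))

-- Colour zero gets the one-dimensional block g only. The products g u ∧ g v that it leaves
-- on edges between other colours are absorbed into the weights for F₂.
module MixedLabels {n m : ℕ} (c : Fin n → Fin (suc m)) (F₁ : Fin n → Fin (suc m) → Bool) where

  g : Fin n → Bool
  g u = if does (c u ≟ zero) then true else F₁ u zero

  g-zero : ∀ {u} → c u ≡ zero → g u ≡ true
  g-zero {u} cu≡0 rewrite dec-true (c u ≟ zero) cu≡0 = refl

  g-nonzero : ∀ {u} → c u ≢ zero → g u ≡ F₁ u zero
  g-nonzero {u} cu≢0 rewrite dec-false (c u ≟ zero) cu≢0 = refl

  colour≢ : ∀ {u i l} → c u ≡ i → l ≢ i → c u ≢ l
  colour≢ cu≡i l≢i cu≡l = l≢i (trans (sym cu≡l) cu≡i)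

  module _ (F₂ : Fin n → Fin (suc m) → Bool) where

    -- Edges meeting colour zero are balanced by `F₁`, which `g` already uses, and all others by
    -- `F₂`. In the blocks of non-zero colours, values at vertices of colour zero matter only on
    -- edges of the first kind and those at other vertices only on edges of the second, so the
    -- choices do not conflict.
    F : Fin n → Fin (suc m) → Bool
    F u l = if does (c u ≟ zero) then F₁ u l else F₂ u l

    F-zero : ∀ {u l} → c u ≡ zero → F u l ≡ F₁ u l
    F-zero {u} cu≡0 rewrite dec-true (c u ≟ zero) cu≡0 = refl

    F-nonzero : ∀ {u l} → c u ≢ zero → F u l ≡ F₂ u l
    F-nonzero {u} cu≢0 rewrite dec-false (c u ≟ zero) cu≢0 = refl

    open Block c F

    labels : Vec (Fin n → Bool) (suc (m * 2))
    labels = g ∷ interleave (p ∘ suc) (q ∘ suc)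

    inner-sum : ∀ u v → inner labels u v ≡ (g u ∧ g v) xor sum (term u v ∘ suc)
    inner-sum u v = cong ((g u ∧ g v) xor_) (inner-interleave (p ∘ suc) (q ∘ suc) u v)

    inner-zero : ∀ {u v j} → c u ≡ zero → c v ≡ suc j →
                 inner labels u v ≡ F₁ u (c v) xor F₁ v (c u)
    inner-zero {u} {v} {j} cu≡0 cv≡j = begin
      inner labels u v                      ≡⟨ inner-sum u v ⟩
      (g u ∧ g v) xor sum (term u v ∘ suc)  ≡⟨ cong₂ _xor_
        (cong₂ _∧_ (g-zero cu≡0) (g-nonzero (colour≢ cv≡j λ ())))
        (sum-single (term u v ∘ suc) j zeros) ⟩
      F₁ v zero xor term u v (suc j)        ≡⟨ cong (F₁ v zero xor_)
        (trans (term-right (colour≢ cu≡0 λ ()) cv≡j) (F-zero cu≡0)) ⟩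
      F₁ v zero xor F₁ u (suc j)            ≡⟨ xor-comm (F₁ v zero) _ ⟩
      F₁ u (suc j) xor F₁ v zero            ≡⟨ cong₂ (λ i l → F₁ u l xor F₁ v i) cu≡0 cv≡j ⟨
      F₁ u (c v) xor F₁ v (c u)             ∎
      where
      open ≡-Reasoning
      zeros : ∀ l → l ≢ j → term u v (suc l) ≡ false
      zeros l l≢j = term-off (colour≢ cu≡0 λ ()) (colour≢ cv≡j (l≢j ∘ suc-injective))

    inner-nonzero : ∀ {u v i j} → c u ≡ suc i → c v ≡ suc j → i ≢ j →
                    inner labels u v ≡ (g u ∧ g v) xor (F₂ u (c v) xor F₂ v (c u))
    inner-nonzero {u} {v} {i} {j} cu≡i cv≡j i≢j =
      trans (inner-sum u v) (cong ((g u ∧ g v) xor_) (begin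
        sum (term u v ∘ suc)                   ≡⟨ sum-pair (term u v ∘ suc) i≢j zeros ⟩
        term u v (suc i) xor term u v (suc j)  ≡⟨ cong₂ _xor_
          (trans (term-left cu≡i (colour≢ cv≡j (i≢j ∘ suc-injective)))
                 (F-nonzero (colour≢ cv≡j λ ())))
          (trans (term-right (colour≢ cu≡i (i≢j ∘ sym ∘ suc-injective)) cv≡j)
                 (F-nonzero (colour≢ cu≡i λ ()))) ⟩
        F₂ v (suc i) xor F₂ u (suc j)          ≡⟨ xor-comm (F₂ v (suc i)) _ ⟩
        F₂ u (suc j) xor F₂ v (suc i)          ≡⟨ cong₂ (λ i l → F₂ u l xor F₂ v i) cu≡i cv≡j ⟨
        F₂ u (c v) xor F₂ v (c u)              ∎))
      where
      open ≡-Reasoning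
      zeros : ∀ l → l ≢ i → l ≢ j → term u v (suc l) ≡ false
      zeros l l≢i l≢j =
        term-off (colour≢ cu≡i (l≢i ∘ suc-injective)) (colour≢ cv≡j (l≢j ∘ suc-injective))

    inner-labels : ∀ {u v b} → c u ≢ c v →
      F₁ u (c v) xor F₁ v (c u) ≡ b → F₂ u (c v) xor F₂ v (c u) ≡ (g u ∧ g v) xor b →
      inner labels u v ≡ b
    inner-labels {u} {v} {b} cu≢cv F₁≡ F₂≡ = split (c u) (c v) refl refl
      where
      split : ∀ i j → c u ≡ i → c v ≡ j → inner labels u v ≡ b
      split zero    zero    cu≡0 cv≡0 = contradiction (trans cu≡0 (sym cv≡0)) cu≢cv
      split zero    (suc _) cu≡0 cv≡j = trans (inner-zero cu≡0 cv≡j) F₁≡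
      split (suc _) zero    cu≡i cv≡0 = trans (inner-comm labels u v)
        (trans (inner-zero cv≡0 cu≡i) (trans (xor-comm (F₁ v (c u)) _) F₁≡))
      -- `g u ∧ g v` enters once through the first coordinate and once through the weight of `F₂`,
      -- and cancels.
      split (suc i) (suc j) cu≡i cv≡j = trans
        (inner-nonzero cu≡i cv≡j λ i≡j → cu≢cv (trans cu≡i (trans (cong suc i≡j) (sym cv≡j))))
        (trans (cong ((g u ∧ g v) xor_) F₂≡) (xor-cancelˡ (g u ∧ g v) b))

-- Diameter bounds by number of colours.

module _ {n : ℕ} {G : Graph n} where

  diam-edgeless : (∀ {u v} → ¬ Adjacent G u v) → diam G ≤ 0
  diam-edgeless edgeless = diam≤ λ o o′ → transforms [] o o′ λ e → ⊥-elim (edgeless e)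

  -- Treated separately because the general count `2k - 1` would give 3.
  diam-twoColours : {c : Fin n → Fin 2} → IsAcyclicColouring G c → diam G ≤ 2
  diam-twoColours {c} colouring = diam≤ λ o o′ →
    let F , balanced = colourPotential colouring (disagreement-sym o o′)
    in transforms (twoLabels c F) o o′ λ {u} {v} e →
         trans (inner-twoLabels c F (IsColouring.proper colouring u v e)) (balanced e)

  diam-manyColours : ∀ {m} {c : Fin n → Fin (suc m)} → IsAcyclicColouring G c → diam G ≤ suc (m * 2)
  diam-manyColours {c = c} colouring = diam≤ λ o o′ →
    let F₁ , balanced₁ = colourPotential colouring (disagreement-sym o o′)
        open MixedLabels c F₁
        -- `F₂` is solved for second, since its weight involves `g` and hence `F₁`.
        F₂ , balanced₂ = colourPotential colouring λ u v →
          cong₂ _xor_ (∧-comm (g u) (g v)) (disagreement-sym o o′ u v)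
    in transforms (labels F₂) o o′ λ {u} {v} e →
         inner-labels F₂ (IsColouring.proper colouring u v e) (balanced₁ e) (balanced₂ e)

acyclicBound : ∀ {n} {G : Graph n} k → AcyclicallyColourable G k → diam G ≤ (4 * k ∸ 7) ⊔ 2
acyclicBound 0 (c , colouring) = ≤-trans (diam-edgeless λ {u} _ → noColour (c u)) z≤n
  where
  noColour : ¬ Fin 0
  noColour ()
acyclicBound {G = G} 1 (c , colouring) = ≤-trans (diam-edgeless edgeless) z≤n
  where
  edgeless : ∀ {u v} → ¬ Adjacent G u v
  edgeless {u} {v} e with c u | c v | IsColouring.proper colouring u v e
  ... | zero | zero | cu≢cv = cu≢cv refl
acyclicBound 2 (c , colouring) = diam-twoColours colouring
acyclicBound (suc (suc (suc m))) (c , colouring) =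
  ≤-trans (diam-manyColours colouring) (≤-trans dimension (m≤m⊔n _ 2))
  where
  -- For `k = 3 + m` the slack between `2k - 1` and `4k - 7` is `m * 2`; adding 7 avoids truncated
  -- subtraction.
  expand : ∀ m → (suc ((2 + m) * 2) + m * 2) + 7 ≡ 4 * (3 + m)
  expand = solve-∀

  dimension : suc ((2 + m) * 2) ≤ 4 * (3 + m) ∸ 7
  dimension = ≤-trans (m≤m+n _ (m * 2))
    (≤-reflexive (trans (sym (m+n∸n≡m _ 7)) (cong (_∸ 7) (expand m))))

star⇒acyclic : ∀ {n k} {G : Graph n} → StarColourable G k → AcyclicallyColourable G k
star⇒acyclic (c , colouring) =
  c , record { proper = proper ; good = λ i j i≢j → proj₁ (good i j i≢j) }
  where open IsColouring colouring

χₐ≤χₛ : ∀ {n} (G : Graph n) → χₐ G ≤ χₛ G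
χₐ≤χₛ G = proj₂ (proj₂ (χₐ-exists G)) (star⇒acyclic (proj₁ (proj₂ (χₛ-exists G))))

theorem1p3 : ∀ n (G : Graph n) →
    (diam G ≤ (4 * χₐ G ∸ 7) ⊔ 2) × ((4 * χₐ G ∸ 7) ⊔ 2 ≤ (4 * χₛ G ∸ 7) ⊔ 2)
theorem1p3 n G =
    acyclicBound (χₐ G) (proj₁ (proj₂ (χₐ-exists G)))
  , ⊔-monoˡ-≤ 2 (∸-monoˡ-≤ 7 (*-monoʳ-≤ 4 (χₐ≤χₛ G)))
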